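{- Every connected graph $G$ with $n$ vertices and $m$ edges embeds isometrically into $\mathrm{Cay}(\mathbb{Z}_2^{n-1}, S)$ for a suitable generating set $S$ of $\mathbb{Z}_2^{n-1}$ with $|S| \leq m$.
   Context: Graphs are finite, simple and undirected; $d_G$ denotes the shortest-path distance of a connected graph $G$. A graph $G$ embeds isometrically into a graph $H$ if there is a map $\lambda: V(G)\to V(H)$ with $d_H(\lambda(u),\lambda(v))=d_G(u,v)$ for all $u,v\in V(G)$. For an abelian group $\Gamma$ (written additively) and a generating set $S\subseteq\Gamma\setminus\{0\}$ with $S=-S$ (automatic in $\mathbb{Z}_2^k$), the Cayley graph $\mathrm{Cay}(\Gamma,S)$ has vertex set $\Gamma$ and edges $\{g,g+s\}$ for $g\in\Gamma$, $s\in S$. -}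

module Defs where

open import Algebra.Bundles using (AbelianGroup)
open import Algebra.Construct.Pointwise using (abelianGroup)
import Algebra.Properties.AbelianGroup as AbelianGroupProperties
open import Data.Fin.Base using (Fin)
open import Data.Nat.Base using (ℕ; zero; suc; _≤_)
open import Data.Parity.Properties using (+-0-abelianGroup)
open import Data.Product.Base using (Σ-syntax; ∃; ∃-syntax; _×_; _,_; proj₁)
open import Data.Sum.Base using (_⊎_; inj₁; inj₂)
open import Function.Bundles using (Func; Inverse; _⟶ₛ_)
open import Level using (Level; 0ℓ; _⊔_) renaming (suc to lsuc)
open import Relation.Binary.Bundles using (Setoid)
import Relation.Binary.Construct.On as On
open import Relation.Binary.Core using (Rel)
open import Relation.Binary.Definitions using (Irreflexive; Symmetric; _Respects_; _Respects₂_)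
import Relation.Binary.PropositionalEquality.Properties as ≡
import Relation.Binary.Reasoning.Setoid as SetoidReasoning
open import Relation.Unary using (Pred; _∈_; _∉_)

private
  variable
    a b c ℓ ℓ′ e e′ s : Level

HasCardinality : Setoid a ℓ → ℕ → Set (a ⊔ ℓ)
HasCardinality X n = Inverse (≡.setoid (Fin n)) X

subsetSetoid : (X : Setoid a ℓ) → Pred (Setoid.Carrier X) s → Setoid (a ⊔ s) ℓ
subsetSetoid X S = On.setoid {B = ∃ λ x → x ∈ S} X proj₁

-- A simple undirected graph.  Vertices form a setoid because the elements of
-- the groups below are functions, compared pointwise.  Finiteness is not built
-- in: it is expressed by HasCardinality for the vertices and the edges.
record Graph v ℓ e : Set (lsuc (v ⊔ ℓ ⊔ e)) where
  field
    vertices : Setoid v ℓ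

  open Setoid vertices public using (_≈_) renaming (Carrier to Vertex)

  field
    Adj    : Rel Vertex e
    resp   : Adj Respects₂ _≈_
    sym    : Symmetric Adj
    irrefl : Irreflexive _≈_ Adj

  -- An edge is presented by its two ends in some order; presentations are
  -- identified when they have the same ends as an unordered pair, and the
  -- proof of adjacency is disregarded.
  Edge : Set (v ⊔ e)
  Edge = Σ[ u ∈ Vertex ] Σ[ w ∈ Vertex ] Adj u w

  _≈ᵉ_ : Rel Edge ℓ
  (u , w , _) ≈ᵉ (u′ , w′ , _) = (u ≈ u′ × w ≈ w′) ⊎ (u ≈ w′ × w ≈ u′)

  edges : Setoid (v ⊔ e) ℓ
  edges = record
    { Carrier       = Edge
    ; _≈_           = _≈ᵉ_
    ; isEquivalence = record
      { refl  = inj₁ (V.refl , V.refl)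
      ; sym   = λ
        { (inj₁ (p , q)) → inj₁ (V.sym p , V.sym q)
        ; (inj₂ (p , q)) → inj₂ (V.sym q , V.sym p)
        }
      ; trans = λ
        { (inj₁ (p , q)) (inj₁ (r , t)) → inj₁ (V.trans p r , V.trans q t)
        ; (inj₁ (p , q)) (inj₂ (r , t)) → inj₂ (V.trans p r , V.trans q t)
        ; (inj₂ (p , q)) (inj₁ (r , t)) → inj₂ (V.trans p t , V.trans q r)
        ; (inj₂ (p , q)) (inj₂ (r , t)) → inj₁ (V.trans p t , V.trans q r)
        }
      }
    }
    where module V = Setoid vertices

  data Walk : Vertex → Vertex → ℕ → Set (v ⊔ ℓ ⊔ e) where
    nil  : ∀ {u w} → u ≈ w → Walk u w zero
    cons : ∀ {u w x k} → Adj u w → Walk w x k → Walk u x (suc k)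

  -- The graph without vertices does not count as connected.
  Connected : Set (v ⊔ ℓ ⊔ e)
  Connected = Vertex × (∀ u w → ∃[ k ] Walk u w k)

  -- IsDistance u w k says d(u , w) = k.  A walk of minimal length repeats no
  -- vertex, so minimising over walks or over paths gives the same number.
  IsDistance : Vertex → Vertex → ℕ → Set (v ⊔ ℓ ⊔ e)
  IsDistance u w k = Walk u w k × (∀ {j} → Walk u w j → k ≤ j)

-- Both distances are required to exist, so the equality of d(u , w) and
-- d(f u , f w) never holds vacuously.
IsIsometric : (G : Graph a ℓ e) (H : Graph b ℓ′ e′) →
              Graph.vertices G ⟶ₛ Graph.vertices H → Set (a ⊔ ℓ ⊔ e ⊔ b ⊔ ℓ′ ⊔ e′)
IsIsometric G H f = ∀ u w → ∃[ k ]
  (Graph.IsDistance G u w k × Graph.IsDistance H (Func.to f u) (Func.to f w) k)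

EmbedsIsometrically : Graph a ℓ e → Graph b ℓ′ e′ → Set (a ⊔ ℓ ⊔ e ⊔ b ⊔ ℓ′ ⊔ e′)
EmbedsIsometrically G H =
  Σ[ f ∈ (Graph.vertices G ⟶ₛ Graph.vertices H) ] IsIsometric G H f

module _ (Γ : AbelianGroup c ℓ) where
  open AbelianGroup Γ

  -- The subgroup generated by S.
  data Span (S : Pred Carrier s) : Pred Carrier (c ⊔ ℓ ⊔ s) where
    gen  : ∀ {x} → x ∈ S → Span S x
    unit : Span S ε
    mul  : ∀ {x y} → Span S x → Span S y → Span S (x ∙ y)
    inv  : ∀ {x} → Span S x → Span S (x ⁻¹)
    resp : ∀ {x y} → x ≈ y → Span S x → Span S y

  record IsGeneratingSet (S : Pred Carrier s) : Set (c ⊔ ℓ ⊔ s) where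
    field
      respects  : S Respects _≈_
      nonzero   : ε ∉ S
      symmetric : ∀ {x} → x ∈ S → x ⁻¹ ∈ S
      generates : ∀ x → x ∈ Span S

  Cay : (S : Pred Carrier s) → IsGeneratingSet S → Graph c ℓ (c ⊔ ℓ ⊔ s)
  Cay S isGen = record
    { vertices = setoid
    ; Adj      = λ g h → ∃[ x ] (x ∈ S × h ≈ g ∙ x)
    ; resp     = (λ { h≈h′ (x , x∈S , p) → x , x∈S , trans (sym h≈h′) p })
               , (λ { g≈g′ (x , x∈S , p) → x , x∈S , trans p (∙-congʳ g≈g′) })
    ; sym      = λ { {g} {h} (x , x∈S , p) → x ⁻¹ , symmetric x∈S , (begin
        g               ≈⟨ identityʳ g ⟨
        g ∙ ε           ≈⟨ ∙-congˡ (inverseʳ x) ⟨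
        g ∙ (x ∙ x ⁻¹)  ≈⟨ assoc g x (x ⁻¹) ⟨
        (g ∙ x) ∙ x ⁻¹  ≈⟨ ∙-congʳ p ⟨
        h ∙ x ⁻¹        ∎) }
    ; irrefl   = λ { {g} {h} g≈h (x , x∈S , p) →
        nonzero (respects (identityʳ-unique g x (trans (sym p) (sym g≈h))) x∈S) }
    }
    where
    open IsGeneratingSet isGen
    open AbelianGroupProperties Γ using (identityʳ-unique)
    open SetoidReasoning setoid

-- Parity under addition is ℤ₂.
ℤ₂^_ : ℕ → AbelianGroup 0ℓ 0ℓ
ℤ₂^ k = abelianGroup (Fin k) +-0-abelianGroup

{-# OPTIONS --safe #-}

-- Send one vertex to 0 and the others to the standard basis of ℤ₂ⁿ⁻¹, and let
-- S consist of the differences φ u + φ w along the edges uw.  A walk of length k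
-- from φ u to φ v in the Cayley graph writes φ u + φ v as a sum of k such
-- differences.  If u is not v then one of them, say u, has a basis vector as its
-- image, so some summand φ u + φ w contains that basis vector; removing it leaves
-- φ w + φ v as a sum of k - 1 differences, and by induction G has a walk of
-- length at most k from u to v.
module Submission where

open import Defs
open import Algebra.Bundles using (AbelianGroup)
import Algebra.Properties.CommutativeSemigroup as CommutativeSemigroupProperties
open import Data.Bool.Base using (if_then_else_)
open import Data.Fin.Base using (Fin; zero; suc)
import Data.Fin.Properties as Fin
open import Data.Nat.Base using (ℕ; zero; suc; _∸_; _≤_; _<_; z≤n; s≤s)
open import Data.Nat.Induction using (<-rec)
open import Data.Nat.Properties using (anyUpTo?; ≮⇒≥; ≤-antisym; ≤-refl)
open import Data.Parity.Base using (Parity; 0ℙ; 1ℙ; _+_)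
open import Data.Parity.Properties as ℙ using (p+p≡0ℙ; +-cancelˡ-≡)
open import Data.Product.Base using (Σ-syntax; ∃; ∃-syntax; _×_; _,_; proj₁; proj₂)
open import Data.Sum.Base using (_⊎_; inj₁; inj₂)
open import Function.Base using (_∘_)
open import Function.Bundles using (Inverse)
open import Level using (Level; 0ℓ)
open import Relation.Binary.Bundles using (Setoid)
open import Relation.Binary.PropositionalEquality
  using (_≡_; refl; sym; trans; cong; cong₂; module ≡-Reasoning)
open import Relation.Nullary using (¬_; Dec; yes; no; does; contradiction)
open import Relation.Unary using (Pred; Decidable; _∈_)

open CommutativeSemigroupProperties ℙ.+-commutativeSemigroup using (xy∙z≈xz∙y; interchange)

-- Arithmetic of parities and least natural numbers.

p+q≡0⇒p≡q : ∀ p q → p + q ≡ 0ℙ → p ≡ q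
p+q≡0⇒p≡q p q eq = +-cancelˡ-≡ p _ _ (trans (p+p≡0ℙ p) (sym eq))

p≡q⇒p+q≡0 : ∀ {p q} → p ≡ q → p + q ≡ 0ℙ
p≡q⇒p+q≡0 {p} refl = p+p≡0ℙ p

p+[p+q]≡q : ∀ p q → p + (p + q) ≡ q
p+[p+q]≡q p q = trans (sym (ℙ.+-assoc p p q)) (cong (_+ q) (p+p≡0ℙ p))

[p+q]+[p+r]≡r+q : ∀ p q r → (p + q) + (p + r) ≡ r + q
[p+q]+[p+r]≡r+q p q r = begin
  (p + q) + (p + r)  ≡⟨ interchange p q p r ⟩
  (p + p) + (q + r)  ≡⟨ cong (_+ (q + r)) (p+p≡0ℙ p) ⟩
  q + r              ≡⟨ ℙ.+-comm q r ⟩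
  r + q              ∎
  where open ≡-Reasoning

least : ∀ {p} {P : Pred ℕ p} → Decidable P → ∀ k → P k → ∃[ l ] (P l × (∀ {j} → P j → l ≤ j))
least {P = P} P? = <-rec (λ k → P k → ∃[ l ] (P l × (∀ {j} → P j → l ≤ j))) descend
  where
  descend : ∀ k → (∀ {i} → i < k → P i → ∃[ l ] (P l × (∀ {j} → P j → l ≤ j))) →
            P k → ∃[ l ] (P l × (∀ {j} → P j → l ≤ j))
  descend k rec Pk with anyUpTo? P? k
  ... | yes (_ , j<k , Pj) = rec j<k Pj
  ... | no  none           = k , Pk , λ {j} Pj → ≮⇒≥ λ j<k → none (j , j<k , Pj)

-- The standard basis of ℤ₂ⁿ.

module _ {n : ℕ} where
  open AbelianGroup (ℤ₂^ n) public using () renaming (Carrier to V; _≈_ to _≈ᵛ_; _∙_ to _⊕_; ε to 𝟘)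

-- point zero is 0, and point (suc i) is the i-th standard basis vector.
point : ∀ {n} → Fin (suc n) → V {n}
point k i = if does (k Fin.≟ suc i) then 1ℙ else 0ℙ

point-suc : ∀ {n} (i : Fin n) → point (suc i) i ≡ 1ℙ
point-suc i with i Fin.≟ i
... | yes _  = refl
... | no i≢i = contradiction refl i≢i

point≡1⇒≡suc : ∀ {n} (k : Fin (suc n)) i → point k i ≡ 1ℙ → k ≡ suc i
point≡1⇒≡suc k i eq with k Fin.≟ suc i
... | yes k≡1+i = k≡1+i
... | no _      = contradiction eq λ ()

point-injective : ∀ {n} (k l : Fin (suc n)) → point k ≈ᵛ point l → k ≡ l
point-injective zero    zero    _  = refl
point-injective zero    (suc j) eq = point≡1⇒≡suc zero j (trans (eq j) (point-suc j))
point-injective (suc i) l       eq = sym (point≡1⇒≡suc l i (trans (sym (eq i)) (point-suc i)))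

-- Induction on the dimension: a vector splits into its first coordinate and a vector supported on
-- the others. It reduces generation of the whole group to reaching each basis vector.
basis-induction : ∀ {p} n (P : Pred (V {n}) p) → (∀ {x y} → x ≈ᵛ y → P x → P y) →
  P 𝟘 → (∀ {x y} → P x → P y → P (x ⊕ y)) → (∀ i → P (point (suc i))) → ∀ x → P x
basis-induction zero    P respects P0 P+ Pb x = respects (λ ()) P0
basis-induction {p} (suc n) P respects P0 P+ Pb x = respects split (P+ (first (x zero)) rest)
  where
  extend : Parity → V {n} → V {suc n}
  extend p y zero    = p
  extend p y (suc i) = y i

  first : ∀ p → P (extend p 𝟘)
  first 0ℙ = respects (λ { zero → refl ; (suc _) → refl }) P0
  first 1ℙ = respects (λ { zero → refl ; (suc _) → refl }) (Pb zero)

  rest : P (extend 0ℙ (x ∘ suc))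
  rest = basis-induction n (P ∘ extend 0ℙ)
    (λ x≈y → respects λ { zero → refl ; (suc i) → x≈y i })
    (respects (λ { zero → refl ; (suc _) → refl }) P0)
    (λ Px Py → respects (λ { zero → refl ; (suc _) → refl }) (P+ Px Py))
    (λ i → respects (λ { zero → refl ; (suc _) → refl }) (Pb (suc i)))
    (x ∘ suc)

  split : extend (x zero) 𝟘 ⊕ extend 0ℙ (x ∘ suc) ≈ᵛ x
  split zero    = ℙ.+-identityʳ (x zero)
  split (suc i) = refl

-- Sums of exactly k members of a family.

module _ {n m : ℕ} (s : Fin m → V {n}) where

  -- Adding `s i` also subtracts it, so each step strips one summand from `x`; repetitions are
  -- allowed.
  IsSum : ℕ → V {n} → Set
  IsSum zero    x = x ≈ᵛ 𝟘
  IsSum (suc k) x = ∃[ i ] IsSum k (x ⊕ s i)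

  IsSum-resp : ∀ k {x y} → x ≈ᵛ y → IsSum k x → IsSum k y
  IsSum-resp zero    x≈y x≈0       i = trans (sym (x≈y i)) (x≈0 i)
  IsSum-resp (suc k) x≈y (i , sum)   = i , IsSum-resp k (λ j → cong (_+ s i j) (x≈y j)) sum

  IsSum? : ∀ k x → Dec (IsSum k x)
  IsSum? zero    x = Fin.all? λ i → x i ℙ.≟ 0ℙ
  IsSum? (suc k) x = Fin.any? λ i → IsSum? k (x ⊕ s i)

  -- Zeros cannot add up to 1, so some summand has a 1 at `c`; by commutativity it may be stripped
  -- first.
  IsSum-remove : ∀ k {x} c → IsSum k x → x c ≡ 1ℙ →
    ∃[ j ] ∃[ i ] (k ≡ suc j × s i c ≡ 1ℙ × IsSum j (x ⊕ s i))
  IsSum-remove zero    c x≈0       xc≡1 = contradiction (trans (sym (x≈0 c)) xc≡1) λ ()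
  IsSum-remove (suc k) {x} c (i , sum) xc≡1 with s i c in sic
  ... | 1ℙ = k , i , refl , sic , sum
  -- This summand vanishes at `c`, so what is left after stripping it still has a 1 there.
  ... | 0ℙ with IsSum-remove k c sum (cong₂ _+_ xc≡1 sic)
  ...   | j , i′ , refl , si′c , sum′ =
    suc j , i′ , refl , si′c , i , IsSum-resp j (λ d → xy∙z≈xz∙y (x d) (s i d) (s i′ d)) sum′

-- Images of vertices and differences along edges.

module Embedding {v ℓ e : Level} (G : Graph v ℓ e) {n m : ℕ}
  (vertices↔ : HasCardinality (Graph.vertices G) (suc n))
  (edges↔ : HasCardinality (Graph.edges G) m)
  (walk : ∀ u w → ∃[ k ] Graph.Walk G u w k)
  where

  open Graph G using (Vertex; _≈_; Adj; Edge; _≈ᵉ_; Walk; nil; cons)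
  private
    module G  = Graph G
    module VG = Setoid G.vertices
    module EG = Setoid G.edges
    module V↔ = Inverse vertices↔
    module E↔ = Inverse edges↔

  index : Vertex → Fin (suc n)
  index = V↔.from

  index-injective : ∀ {u w} → index u ≡ index w → u ≈ w
  index-injective {u} {w} eq = VG.trans (VG.sym (V↔.strictlyInverseˡ u)) (V↔.inverseˡ eq)

  φ : Vertex → V {n}
  φ u = point (index u)

  φ-cong : ∀ {u w} → u ≈ w → φ u ≈ᵛ φ w
  φ-cong u≈w i = cong (λ k → point k i) (V↔.from-cong u≈w)

  φ-injective : ∀ {u w} → φ u ≈ᵛ φ w → u ≈ w
  φ-injective eq = index-injective (point-injective _ _ eq)

  φ≡1 : ∀ {u i} → index u ≡ suc i → φ u i ≡ 1ℙ
  φ≡1 {i = i} eq = trans (cong (λ k → point k i) eq) (point-suc i)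

  φ≡0 : ∀ {u w i} → index u ≡ suc i → ¬ u ≈ w → φ w i ≡ 0ℙ
  φ≡0 {u} {w} {i} eq u≉w with φ w i in φwi
  ... | 0ℙ = refl
  ... | 1ℙ = contradiction (index-injective (trans eq (sym (point≡1⇒≡suc _ i φwi)))) u≉w

  -- Only one vertex is sent to 0, so of two distinct vertices at least one is sent to a basis
  -- vector.
  one-index-suc : ∀ {u w} → ¬ u ≈ w → (∃[ i ] index u ≡ suc i) ⊎ (∃[ i ] index w ≡ suc i)
  one-index-suc {u} {w} u≉w with index u in equ | index w in eqw
  ... | suc i | _     = inj₁ (i , refl)
  ... | zero  | suc i = inj₂ (i , refl)
  ... | zero  | zero  = contradiction (index-injective (trans equ (sym eqw))) u≉w

  δ : Edge → V {n}
  δ (a , b , _) = φ a ⊕ φ b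

  δ-cong : ∀ {d e} → d ≈ᵉ e → δ d ≈ᵛ δ e
  δ-cong (inj₁ (p , q)) i = cong₂ _+_ (φ-cong p i) (φ-cong q i)
  δ-cong {e = a , b , _} (inj₂ (p , q)) i =
    trans (cong₂ _+_ (φ-cong p i) (φ-cong q i)) (ℙ.+-comm (φ b i) (φ a i))

  -- Only the image of `u` has a 1 at `i`, so a difference with a 1 there comes from an edge at `u`.
  -- The edge is turned so that `u` comes first.
  incident : ∀ {u i} → index u ≡ suc i → ∀ e → δ e i ≡ 1ℙ →
    ∃[ w ] Σ[ uw ∈ Adj u w ] (u , w , uw) ≈ᵉ e
  incident {u} {i} eq (a , b , ab) δi with φ a i in φai
  ... | 1ℙ = b , proj₂ G.resp (VG.sym u≈a) ab , inj₁ (u≈a , VG.refl)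
    where
    u≈a : u ≈ a
    u≈a = index-injective (trans eq (sym (point≡1⇒≡suc _ i φai)))
  ... | 0ℙ = a , proj₂ G.resp (VG.sym u≈b) (G.sym ab) , inj₂ (u≈b , VG.refl)
    where
    u≈b : u ≈ b
    u≈b = index-injective (trans eq (sym (point≡1⇒≡suc _ i δi)))

  -- The 1 at coordinate `i` makes `a` an end of `e`; cancelling `φ a` then identifies the other
  -- ends.
  δ-injective-at : ∀ {a b i} (ab : Adj a b) → index a ≡ suc i →
    ∀ e → δ (a , b , ab) ≈ᵛ δ e → (a , b , ab) ≈ᵉ e
  δ-injective-at {a} {b} {i} ab eq e δ≈
    with w , aw , aw≈e ← incident eq e
           (trans (sym (δ≈ i)) (cong₂ _+_ (φ≡1 eq) (φ≡0 eq λ a≈b → G.irrefl a≈b ab)))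
    = EG.trans {i = a , b , ab} {j = a , w , aw} {k = e} (inj₁ (VG.refl , b≈w)) aw≈e
    where
    b≈w : b ≈ w
    b≈w = φ-injective λ j →
      +-cancelˡ-≡ (φ a j) _ _ (trans (δ≈ j) (sym (δ-cong {a , w , aw} {e} aw≈e j)))

  δ-injective : ∀ d e → δ d ≈ᵛ δ e → d ≈ᵉ e
  δ-injective (a , b , ab) e δ≈ with one-index-suc (λ a≈b → G.irrefl a≈b ab)
  ... | inj₁ (_ , eq) = δ-injective-at ab eq e δ≈
  ... | inj₂ (_ , eq) = EG.trans {i = a , b , ab} {j = b , a , G.sym ab} {k = e}
    (inj₂ (VG.refl , VG.refl))
    (δ-injective-at (G.sym ab) eq e λ i → trans (ℙ.+-comm (φ b i) (φ a i)) (δ≈ i))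

  -- The generating set.

  s : Fin m → V {n}
  s i = δ (E↔.to i)

  S : Pred (V {n}) 0ℓ
  S x = ∃[ i ] x ≈ᵛ s i

  δ∈S : ∀ e → δ e ∈ S
  δ∈S e = E↔.from e , δ-cong {e} {E↔.to (E↔.from e)} (EG.sym {E↔.to (E↔.from e)} {e} (E↔.strictlyInverseˡ e))

  -- Traversing an edge adds its difference, which lies in `S`, to the image of the current vertex.
  walk-span : ∀ {u w k} → Walk u w k → φ u ∈ Span (ℤ₂^ n) S → φ w ∈ Span (ℤ₂^ n) S
  walk-span (nil u≈w)    φu = resp (φ-cong u≈w) φu
  walk-span {u} (cons {w = w} uw ws) φu =
    walk-span ws (resp (λ i → p+[p+q]≡q (φ u i) (φ w i)) (mul φu (gen (δ∈S (_ , _ , uw)))))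

  φ-to : ∀ k → φ (V↔.to k) ≈ᵛ point k
  φ-to k i = cong (λ l → point l i) (V↔.strictlyInverseʳ k)

  isGeneratingSet : IsGeneratingSet (ℤ₂^ n) S
  isGeneratingSet = record
    { respects  = λ x≈y (i , x≈si) → i , λ j → trans (sym (x≈y j)) (x≈si j)
    -- A zero difference would make the edge a loop.
    ; nonzero   = λ (i , 0≈si) → let a , b , ab = E↔.to i in
        G.irrefl (φ-injective λ j → p+q≡0⇒p≡q (φ a j) (φ b j) (sym (0≈si j))) ab
    -- Negation of parities computes to the identity.
    ; symmetric = λ x∈S → x∈S
    -- Walks from the vertex sent to 0 reach every basis vector.
    ; generates = basis-induction n (Span (ℤ₂^ n) S) resp unit mul λ i →
        resp (φ-to (suc i))
          (walk-span (proj₂ (walk (V↔.to zero) _)) (resp (λ j → sym (φ-to zero j)) unit))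
    }

  |S|≡m : HasCardinality (subsetSetoid (AbelianGroup.setoid (ℤ₂^ n)) S) m
  |S|≡m = record
    { to        = λ i → s i , i , λ _ → refl
    ; from      = λ (_ , i , _) → i
    ; to-cong   = λ { refl _ → refl }
    -- Equal members carry the same edge number as witness because `δ` is injective.
    ; from-cong = λ {x} {y} → from-cong {x} {y}
    ; inverse   = (λ { {_ , _ , x≈si} refl j → sym (x≈si j) })
                , (λ {i} {y} y≈si → from-cong {y} {s i , i , λ _ → refl} y≈si)
    }
    where
    from-cong : ∀ {x y : ∃ S} → proj₁ x ≈ᵛ proj₁ y → proj₁ (proj₂ x) ≡ proj₁ (proj₂ y)
    from-cong {_ , i , x≈si} {_ , j , y≈sj} x≈y =
      trans (sym (E↔.strictlyInverseʳ i)) (E↔.inverseʳ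
        (δ-injective (E↔.to i) (E↔.to j) λ c → trans (sym (x≈si c)) (trans (x≈y c) (y≈sj c))))

  -- Comparison of walks and distances.

  C : Graph 0ℓ 0ℓ 0ℓ
  C = Cay (ℤ₂^ n) S isGeneratingSet

  walk-image : ∀ {u w k} → Walk u w k → Graph.Walk C (φ u) (φ w) k
  walk-image (nil u≈w)    = Graph.nil (φ-cong u≈w)
  walk-image {u} (cons {w = w} uw ws) =
    Graph.cons (_ , δ∈S (_ , _ , uw) , λ i → sym (p+[p+q]≡q (φ u i) (φ w i))) (walk-image ws)

  walk⇒sum : ∀ {x y k} → Graph.Walk C x y k → IsSum s k (x ⊕ y)
  walk⇒sum (Graph.nil x≈y) i = p≡q⇒p+q≡0 (x≈y i)
  walk⇒sum {x} {z} {suc k} (Graph.cons {w = y} (t , (i , t≈si) , y≈x+t) ws) =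
    i , IsSum-resp s k y+z≈x+z+si (walk⇒sum ws)
    where
    y+z≈x+z+si : y ⊕ z ≈ᵛ (x ⊕ z) ⊕ s i
    y+z≈x+z+si c = trans (cong (_+ z c) (trans (y≈x+t c) (cong (x c +_) (t≈si c))))
                         (xy∙z≈xz∙y (x c) (s i c) (z c))

  snoc : ∀ {u w x k} → Walk u w k → Adj w x → Walk u x (suc k)
  snoc (nil u≈w)    wx = cons (proj₂ G.resp (VG.sym u≈w) wx) (nil VG.refl)
  snoc (cons uy ys) wx = cons uy (snoc ys wx)

  -- The sum has a 1 at `c`, so one summand is the difference along an edge at `u`; removing it
  -- trades `φ u` for `φ w`.
  sum-remove-vertex : ∀ {u v c} k → index u ≡ suc c → ¬ u ≈ v →
    IsSum s k (φ u ⊕ φ v) →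
    ∃[ j ] ∃[ w ] (k ≡ suc j × Adj u w × IsSum s j (φ w ⊕ φ v))
  sum-remove-vertex {u} {v} {c} k eq u≉v sum
    with j , i , k≡1+j , sic≡1 , sum′ ← IsSum-remove s k c sum (cong₂ _+_ (φ≡1 eq) (φ≡0 eq u≉v))
    with w , uw , uw≈si ← incident eq (E↔.to i) sic≡1
    = j , w , k≡1+j , uw , IsSum-resp s j (λ d →
        trans (cong (φ u d + φ v d +_) (sym (δ-cong {u , w , uw} {E↔.to i} uw≈si d)))
              ([p+q]+[p+r]≡r+q (φ u d) (φ v d) (φ w d)))
        sum′

  sum⇒walk : ∀ k {u v} → IsSum s k (φ u ⊕ φ v) → ∃[ j ] (j ≤ k × Walk u v j)
  sum⇒walk k {u} {v} sum with index u Fin.≟ index v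
  -- Any leftover summands cancel out and are dropped, which is why the length is only bounded by
  -- `k`.
  ... | yes u≡v = 0 , z≤n , nil (index-injective u≡v)
  ... | no  u≢v with one-index-suc (u≢v ∘ V↔.from-cong)
  ...   | inj₁ (_ , eq)
    with _ , _ , refl , uw , sum′ ← sum-remove-vertex k eq (u≢v ∘ V↔.from-cong) sum
    with _ , j≤k , ws ← sum⇒walk _ sum′
    = _ , s≤s j≤k , cons uw ws
  -- Now `v` has the basis vector, so the edge found is at `v` and goes at the end of the walk.
  ...   | inj₂ (_ , eq)
    with _ , w , refl , vw , sum′ ← sum-remove-vertex k eq (u≢v ∘ sym ∘ V↔.from-cong)
           (IsSum-resp s k (λ c → ℙ.+-comm (φ u c) (φ v c)) sum)
    with _ , j≤k , ws ← sum⇒walk _ {u} {w} (IsSum-resp s _ (λ c → ℙ.+-comm (φ w c) (φ u c)) sum′)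
    = _ , s≤s j≤k , snoc ws (G.sym vw)

  isometric : IsIsometric G C (record { to = φ ; cong = φ-cong })
  isometric u w
    -- The least number `d` of summands is the common distance: it yields a walk in `G` of length at
    -- most `d`, and every walk in either graph yields a sum with as many summands as steps.
    with d , sum , d≤ ← least (λ k → IsSum? s k (φ u ⊕ φ w)) _ (walk⇒sum (walk-image (proj₂ (walk u w))))
    with j , j≤d , ws ← sum⇒walk d sum
    with refl ← ≤-antisym j≤d (d≤ (walk⇒sum (walk-image ws)))
    = j , (ws , λ xs → d≤ (walk⇒sum (walk-image xs)))
        , (walk-image ws , λ xs → d≤ (walk⇒sum xs))

theorem2p5 : ∀ {v ℓ e : Level} (G : Graph v ℓ e) (n m : ℕ) →
    HasCardinality (Graph.vertices G) n →
    HasCardinality (Graph.edges G) m →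
    Graph.Connected G →
    Σ[ S ∈ Pred (AbelianGroup.Carrier (ℤ₂^ (n ∸ 1))) 0ℓ ]
    Σ[ isGen ∈ IsGeneratingSet (ℤ₂^ (n ∸ 1)) S ]
    ((∃[ k ] (HasCardinality (subsetSetoid (AbelianGroup.setoid (ℤ₂^ (n ∸ 1))) S) k × k ≤ m))
    × EmbedsIsometrically G (Cay (ℤ₂^ (n ∸ 1)) S isGen))
theorem2p5 G zero    m vertices↔ edges↔ (root , _) = contradiction (Inverse.from vertices↔ root) λ ()
theorem2p5 G (suc n) m vertices↔ edges↔ (_ , walk) =
  S , isGeneratingSet , (m , |S|≡m , ≤-refl) , (record { to = φ ; cong = φ-cong } , isometric)
  where open Embedding G vertices↔ edges↔ walk
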